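{- Let $\mathbb{K}$ be a field, let $(\Omega,\leftarrow,\rightarrow,\triangleleft,\triangleright)$ be an extended diassociative semigroup (EDS) and let $A$ be a $\mathbb{K}$-vector space equipped with bilinear products $\prec_\alpha$ and $\succ_\alpha$ for $\alpha\in\Omega$. Equip $\mathbb{K}\Omega\otimes A$ with the two bilinear products $\prec,\succ$ defined, for all $\alpha,\beta\in\Omega$ and $x,y\in A$, by $$(\alpha\otimes x)\prec(\beta\otimes y)=(\alpha\leftarrow\beta)\otimes(x\prec_{\alpha\triangleleft\beta}y),\qquad(\alpha\otimes x)\succ(\beta\otimes y)=(\alpha\rightarrow\beta)\otimes(x\succ_{\alpha\triangleright\beta}y).$$ 1. If $(A,(\prec_\alpha)_{\alpha\in\Omega},(\succ_\alpha)_{\alpha\in\Omega})$ is an $\Omega$-dendriform algebra, then $(\mathbb{K}\Omega\otimes A,\prec,\succ)$ is a dendriform algebra. 2. If the maps $\varphi_\leftarrow:(\alpha,\beta)\mapsto(\alpha\leftarrow\beta,\alpha\triangleleft\beta)$ and $\varphi_\rightarrow:(\alpha,\beta)\mapsto(\alpha\rightarrow\beta,\alpha\triangleright\beta)$ from $\Omega^2$ to $\Omega^2$ are surjective, then the converse implication is true.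
   Context: Extended diassociative semigroups. A diassociative semigroup is a set $\Omega$ with maps $\leftarrow,\rightarrow:\Omega\times\Omega\to\Omega$ such that for all $\alpha,\beta,\gamma\in\Omega$: $(\alpha\leftarrow\beta)\leftarrow\gamma=\alpha\leftarrow(\beta\leftarrow\gamma)=\alpha\leftarrow(\beta\rightarrow\gamma)$; $(\alpha\rightarrow\beta)\leftarrow\gamma=\alpha\rightarrow(\beta\leftarrow\gamma)$; $(\alpha\rightarrow\beta)\rightarrow\gamma=(\alpha\leftarrow\beta)\rightarrow\gamma=\alpha\rightarrow(\beta\rightarrow\gamma)$. An extended diassociative semigroup (EDS) is $(\Omega,\leftarrow,\rightarrow,\triangleleft,\triangleright)$ such that $(\Omega,\leftarrow,\rightarrow)$ is a diassociative semigroup and for all $\alpha,\beta,\gamma\in\Omega$: $\alpha\triangleright(\beta\leftarrow\gamma)=\alpha\triangleright\beta$; $(\alpha\rightarrow\beta)\triangleleft\gamma=\beta\triangleleft\gamma$; $(\alpha\triangleleft\beta)\leftarrow((\alpha\leftarrow\beta)\triangleleft\gamma)=\alpha\triangleleft(\beta\leftarrow\gamma)$; $(\alpha\triangleleft\beta)\triangleleft((\alpha\leftarrow\beta)\triangleleft\gamma)=\beta\triangleleft\gamma$; $(\alpha\triangleleft\beta)\rightarrow((\alpha\leftarrow\beta)\triangleleft\gamma)=\alpha\triangleleft(\beta\rightarrow\gamma)$; $(\alpha\triangleleft\beta)\triangleright((\alpha\leftarrow\beta)\triangleleft\gamma)=\beta\triangleright\gamma$; $(\alpha\triangleright(\beta\rightarrow\gamma))\leftarrow(\beta\triangleright\gamma)=(\alpha\leftarrow\beta)\triangleright\gamma$;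 $(\alpha\triangleright(\beta\rightarrow\gamma))\triangleleft(\beta\triangleright\gamma)=\alpha\triangleleft\beta$; $(\alpha\triangleright(\beta\rightarrow\gamma))\rightarrow(\beta\triangleright\gamma)=(\alpha\rightarrow\beta)\triangleright\gamma$; $(\alpha\triangleright(\beta\rightarrow\gamma))\triangleright(\beta\triangleright\gamma)=\alpha\triangleright\beta$. $\Omega$-dendriform algebra: a $\mathbb{K}$-vector space $A$ with bilinear products $\prec_\alpha,\succ_\alpha$ ($\alpha\in\Omega$) such that for all $x,y,z\in A$, $\alpha,\beta\in\Omega$: $(x\prec_\alpha y)\prec_\beta z=x\prec_{\alpha\leftarrow\beta}(y\prec_{\alpha\triangleleft\beta}z)+x\prec_{\alpha\rightarrow\beta}(y\succ_{\alpha\triangleright\beta}z)$; $x\succ_\alpha(y\prec_\beta z)=(x\succ_\alpha y)\prec_\beta z$; $x\succ_\alpha(y\succ_\beta z)=(x\succ_{\alpha\triangleright\beta}y)\succ_{\alpha\rightarrow\beta}z+(x\prec_{\alpha\triangleleft\beta}y)\succ_{\alpha\leftarrow\beta}z$. Dendriform algebra: a vector space with bilinear products $\prec,\succ$ such that $(x\prec y)\prec z=x\prec(y\prec z+y\succ z)$, $(x\succ y)\prec z=x\succ(y\prec z)$, $(x\prec y+x\succ y)\succ z=x\succ(y\succ z)$. $\mathbb{K}\Omega$ is the vector space with basis $\Omega$. -}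

module Defs where

open import Level using (Level; _⊔_; suc)
open import Algebra.Apartness.Bundles using (HeytingField; HeytingCommutativeRing)
open import Algebra.Bundles using (CommutativeMonoid; CommutativeRing)
open import Algebra.Core using (Op₂)
open import Algebra.Module.Bundles using (Module)
open import Algebra.Module.Structures.Biased using (IsModuleFromLeft)
import Algebra.Definitions as AlgebraicDefinitions
import Algebra.Properties.CommutativeSemigroup as CommutativeSemigroupProperties
open import Data.Product.Base using (_×_; _,_)
open import Data.Product.Relation.Binary.Pointwise.NonDependent using (Pointwise)
open import Function.Definitions using (Surjective)
open import Relation.Binary.Bundles using (Setoid)
open import Relation.Binary.Core using (Rel)
open import Relation.Binary.Structures using (IsEquivalence)
open import Relation.Binary.PropositionalEquality.Core using (_≡_; refl)
import Relation.Binary.Reasoning.Setoid as SetoidReasoning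

module _ {o ℓ} {Ω : Set o} (_≈_ : Rel Ω ℓ) where

  open AlgebraicDefinitions _≈_ using (Congruent₂)

  record IsDiassociativeSemigroup (_⟵_ _⟶_ : Op₂ Ω) : Set (o ⊔ ℓ) where
    field
      isEquivalence : IsEquivalence _≈_
      ⟵-cong        : Congruent₂ _⟵_
      ⟶-cong        : Congruent₂ _⟶_
      ⟵-assoc       : ∀ α β γ → ((α ⟵ β) ⟵ γ) ≈ (α ⟵ (β ⟵ γ))
      ⟵-⟵≈⟵-⟶       : ∀ α β γ → (α ⟵ (β ⟵ γ)) ≈ (α ⟵ (β ⟶ γ))
      ⟶-⟵-assoc     : ∀ α β γ → ((α ⟶ β) ⟵ γ) ≈ (α ⟶ (β ⟵ γ))
      ⟶-⟶≈⟵-⟶       : ∀ α β γ → ((α ⟶ β) ⟶ γ) ≈ ((α ⟵ β) ⟶ γ)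
      ⟵-⟶-assoc     : ∀ α β γ → ((α ⟵ β) ⟶ γ) ≈ (α ⟶ (β ⟶ γ))

  record IsEDS (_⟵_ _⟶_ _◁_ _▷_ : Op₂ Ω) : Set (o ⊔ ℓ) where
    field
      isDiassociativeSemigroup : IsDiassociativeSemigroup _⟵_ _⟶_
      ◁-cong : Congruent₂ _◁_
      ▷-cong : Congruent₂ _▷_
      ▷-⟵    : ∀ α β γ → (α ▷ (β ⟵ γ)) ≈ (α ▷ β)
      ⟶-◁    : ∀ α β γ → ((α ⟶ β) ◁ γ) ≈ (β ◁ γ)
      ◁-⟵-◁  : ∀ α β γ → ((α ◁ β) ⟵ ((α ⟵ β) ◁ γ)) ≈ (α ◁ (β ⟵ γ))
      ◁-◁-◁  : ∀ α β γ → ((α ◁ β) ◁ ((α ⟵ β) ◁ γ)) ≈ (β ◁ γ)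
      ◁-⟶-◁  : ∀ α β γ → ((α ◁ β) ⟶ ((α ⟵ β) ◁ γ)) ≈ (α ◁ (β ⟶ γ))
      ◁-▷-◁  : ∀ α β γ → ((α ◁ β) ▷ ((α ⟵ β) ◁ γ)) ≈ (β ▷ γ)
      ▷-⟵-▷  : ∀ α β γ → ((α ▷ (β ⟶ γ)) ⟵ (β ▷ γ)) ≈ ((α ⟵ β) ▷ γ)
      ▷-◁-▷  : ∀ α β γ → ((α ▷ (β ⟶ γ)) ◁ (β ▷ γ)) ≈ (α ◁ β)
      ▷-⟶-▷  : ∀ α β γ → ((α ▷ (β ⟶ γ)) ⟶ (β ▷ γ)) ≈ ((α ⟶ β) ▷ γ)
      ▷-▷-▷  : ∀ α β γ → ((α ▷ (β ⟶ γ)) ▷ (β ▷ γ)) ≈ (α ▷ β)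

    open IsDiassociativeSemigroup isDiassociativeSemigroup public

record EDS o ℓ : Set (suc (o ⊔ ℓ)) where
  infix  4 _≈_
  infixl 7 _⟵_ _⟶_ _◁_ _▷_
  field
    Carrier : Set o
    _≈_     : Rel Carrier ℓ
    _⟵_     : Op₂ Carrier
    _⟶_     : Op₂ Carrier
    _◁_     : Op₂ Carrier
    _▷_     : Op₂ Carrier
    isEDS   : IsEDS _≈_ _⟵_ _⟶_ _◁_ _▷_

  open IsEDS isEDS public

  setoid : Setoid o ℓ
  setoid = record { isEquivalence = isEquivalence }

  φ⟵ : Carrier × Carrier → Carrier × Carrier
  φ⟵ (α , β) = (α ⟵ β) , (α ◁ β)

  φ⟶ : Carrier × Carrier → Carrier × Carrier
  φ⟶ (α , β) = (α ⟶ β) , (α ▷ β)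

  IsSurjective : (Carrier × Carrier → Carrier × Carrier) → Set (o ⊔ ℓ)
  IsSurjective = Surjective (Pointwise _≈_ _≈_) (Pointwise _≈_ _≈_)

-- The apartness relation of a Heyting field makes exactly the invertible
-- elements apart from 0# and is tight; classically it is inequality, and
-- these are the fields.

scalars : ∀ {c ℓ₁ ℓ₂} → HeytingField c ℓ₁ ℓ₂ → CommutativeRing c ℓ₁
scalars K = HeytingCommutativeRing.commutativeRing (HeytingField.heytingCommutativeRing K)

module _ {c ℓ} {R : CommutativeRing c ℓ} where

  private module R = CommutativeRing R

  module _ {m ℓm} (M : Module R m ℓm) where

    open Module M
    open AlgebraicDefinitions _≈ᴹ_
      using (Congruent₂; _DistributesOverˡ_; _DistributesOverʳ_)

    record IsBilinear (_∙_ : Op₂ Carrierᴹ) : Set (c ⊔ m ⊔ ℓm) where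
      field
        ∙-cong   : Congruent₂ _∙_
        distribˡ : _∙_ DistributesOverˡ _+ᴹ_
        distribʳ : _∙_ DistributesOverʳ _+ᴹ_
        scaleˡ   : ∀ r x y → ((r *ₗ x) ∙ y) ≈ᴹ (r *ₗ (x ∙ y))
        scaleʳ   : ∀ r x y → (x ∙ (r *ₗ y)) ≈ᴹ (r *ₗ (x ∙ y))

    record BilinearProduct : Set (c ⊔ m ⊔ ℓm) where
      infixl 7 _∙_
      field
        _∙_        : Op₂ Carrierᴹ
        isBilinear : IsBilinear _∙_

      open IsBilinear isBilinear public

    record BilinearFamily {o ℓo} (Ω : Setoid o ℓo) : Set (c ⊔ m ⊔ ℓm ⊔ o ⊔ ℓo) where
      private module Ω = Setoid Ω
      field
        op         : Ω.Carrier → Op₂ Carrierᴹ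
        index-cong : ∀ {α β} → α Ω.≈ β → ∀ x y → op α x y ≈ᴹ op β x y
        isBilinear : ∀ α → IsBilinear (op α)

      private module B α = IsBilinear (isBilinear α)
      open B public

  record IsDendriform {m ℓm} (M : Module R m ℓm) (prec succ : BilinearProduct M)
                      : Set (m ⊔ ℓm) where
    open Module M
    open BilinearProduct prec using () renaming (_∙_ to infixl 7 _≺_)
    open BilinearProduct succ using () renaming (_∙_ to infixl 7 _≻_)
    field
      ≺-≺ : ∀ x y z → (x ≺ y) ≺ z ≈ᴹ x ≺ (y ≺ z +ᴹ y ≻ z)
      ≻-≺ : ∀ x y z → (x ≻ y) ≺ z ≈ᴹ x ≻ (y ≺ z)
      ≻-≻ : ∀ x y z → (x ≺ y +ᴹ x ≻ y) ≻ z ≈ᴹ x ≻ (y ≻ z)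

  record IsΩDendriform {o ℓo m ℓm} (Ω : EDS o ℓo) (A : Module R m ℓm)
                       (prec succ : BilinearFamily A (EDS.setoid Ω))
                       : Set (o ⊔ m ⊔ ℓm) where
    open EDS Ω using (_⟵_; _⟶_; _◁_; _▷_) renaming (Carrier to ∣Ω∣)
    open Module A

    infixl 7 _≺[_]_ _≻[_]_

    _≺[_]_ : Carrierᴹ → ∣Ω∣ → Carrierᴹ → Carrierᴹ
    x ≺[ α ] y = BilinearFamily.op prec α x y

    _≻[_]_ : Carrierᴹ → ∣Ω∣ → Carrierᴹ → Carrierᴹ
    x ≻[ α ] y = BilinearFamily.op succ α x y

    field
      ≺-≺ : ∀ α β x y z →
            (x ≺[ α ] y) ≺[ β ] z ≈ᴹ
            x ≺[ α ⟵ β ] (y ≺[ α ◁ β ] z) +ᴹ x ≺[ α ⟶ β ] (y ≻[ α ▷ β ] z)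
      ≻-≺ : ∀ α β x y z →
            x ≻[ α ] (y ≺[ β ] z) ≈ᴹ (x ≻[ α ] y) ≺[ β ] z
      ≻-≻ : ∀ α β x y z →
            x ≻[ α ] (y ≻[ β ] z) ≈ᴹ
            (x ≻[ α ▷ β ] y) ≻[ α ⟶ β ] z +ᴹ (x ≺[ α ◁ β ] y) ≻[ α ⟵ β ] z

  -- Modules presented by generators and relations.  In the absence of
  -- quotient types the carrier consists of formal expressions, and all
  -- identifications are made by the setoid equality _⊢_≋_.

  infixl 6 _⊕_
  infixr 7 _·_

  data Term {x} (X : Set x) : Set (c ⊔ x) where
    gen : X → Term X
    𝟎   : Term X
    _⊕_ : Term X → Term X → Term X
    _·_ : R.Carrier → Term X → Term X

  infix 4 _⊢_≋_

  data _⊢_≋_ {x ℓx} {X : Set x} (_∼_ : Rel (Term X) ℓx)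
             : Term X → Term X → Set (c ⊔ ℓ ⊔ x ⊔ ℓx) where
    rel        : ∀ {s t} → s ∼ t → _∼_ ⊢ s ≋ t
    refl       : ∀ {t} → _∼_ ⊢ t ≋ t
    sym        : ∀ {s t} → _∼_ ⊢ s ≋ t → _∼_ ⊢ t ≋ s
    trans      : ∀ {s t u} → _∼_ ⊢ s ≋ t → _∼_ ⊢ t ≋ u → _∼_ ⊢ s ≋ u
    ⊕-cong     : ∀ {s s′ t t′} → _∼_ ⊢ s ≋ s′ → _∼_ ⊢ t ≋ t′ → _∼_ ⊢ s ⊕ t ≋ s′ ⊕ t′
    ·-cong     : ∀ {a b s t} → a R.≈ b → _∼_ ⊢ s ≋ t → _∼_ ⊢ a · s ≋ b · t
    ⊕-assoc    : ∀ s t u → _∼_ ⊢ (s ⊕ t) ⊕ u ≋ s ⊕ (t ⊕ u)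
    ⊕-comm     : ∀ s t → _∼_ ⊢ s ⊕ t ≋ t ⊕ s
    ⊕-identity : ∀ t → _∼_ ⊢ 𝟎 ⊕ t ≋ t
    ·-zero     : ∀ t → _∼_ ⊢ R.0# · t ≋ 𝟎
    ·-identity : ∀ t → _∼_ ⊢ R.1# · t ≋ t
    ·-assoc    : ∀ a b t → _∼_ ⊢ (a R.* b) · t ≋ a · (b · t)
    ·-distribˡ : ∀ a s t → _∼_ ⊢ a · (s ⊕ t) ≋ a · s ⊕ a · t
    ·-distribʳ : ∀ a b t → _∼_ ⊢ (a R.+ b) · t ≋ a · t ⊕ b · t

  Presented : ∀ {x ℓx} {X : Set x} → Rel (Term X) ℓx →
              Module R (c ⊔ x) (c ⊔ ℓ ⊔ x ⊔ ℓx)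
  Presented {X = X} _∼_ = record
    { Carrierᴹ = Term X
    ; _≈ᴹ_     = _∼_ ⊢_≋_
    ; _+ᴹ_     = _⊕_
    ; _*ₗ_     = _·_
    ; _*ᵣ_     = λ t a → a · t
    ; 0ᴹ       = 𝟎
    ; -ᴹ_      = λ t → (R.- R.1#) · t
    ; isModule = IsModuleFromLeft.isModule {commutativeRing = R} (record
      { isLeftModule = record
        { isLeftSemimodule = record
          { +ᴹ-isCommutativeMonoid = record
            { isMonoid = record
              { isSemigroup = record
                { isMagma = record
                  { isEquivalence = record { refl = refl ; sym = sym ; trans = trans }
                  ; ∙-cong        = ⊕-cong
                  }
                ; assoc = ⊕-assoc
                }
              ; identity = ⊕-identity , λ t → trans (⊕-comm t 𝟎) (⊕-identity t)
              }
            ; comm = ⊕-comm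
            }
          ; isPreleftSemimodule = record
            { *ₗ-cong      = ·-cong
            ; *ₗ-zeroˡ     = ·-zero
            ; *ₗ-distribʳ  = λ t a b → ·-distribʳ a b t
            ; *ₗ-identityˡ = ·-identity
            ; *ₗ-assoc     = ·-assoc
            ; *ₗ-zeroʳ     = ·-zeroʳ
            ; *ₗ-distribˡ  = ·-distribˡ
            }
          }
        ; -ᴹ‿cong    = ·-cong R.refl
        ; -ᴹ‿inverse = inverseˡ , λ t → trans (⊕-comm _ _) (inverseˡ t)
        }
      })
    }
    where
    ·-zeroʳ : ∀ a → _∼_ ⊢ a · 𝟎 ≋ 𝟎
    ·-zeroʳ a =
      trans (·-cong R.refl (sym (·-zero 𝟎)))
      (trans (sym (·-assoc a R.0# 𝟎))
      (trans (·-cong (R.zeroʳ a) refl) (·-zero 𝟎)))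

    inverseˡ : ∀ t → _∼_ ⊢ (R.- R.1#) · t ⊕ t ≋ 𝟎
    inverseˡ t =
      trans (⊕-cong refl (sym (·-identity t)))
      (trans (sym (·-distribʳ (R.- R.1#) R.1# t))
      (trans (·-cong (R.-‿inverseˡ R.1#) refl) (·-zero t)))

  data BasisRel {o ℓo} (Ω : Setoid o ℓo) : Rel (Term (Setoid.Carrier Ω)) (c ⊔ o ⊔ ℓo) where
    basis : ∀ {α β} → Setoid._≈_ Ω α β → BasisRel Ω (gen α) (gen β)

  Free : ∀ {o ℓo} → Setoid o ℓo → Module R (c ⊔ o) (c ⊔ ℓ ⊔ o ⊔ ℓo)
  Free Ω = Presented (BasisRel Ω)

  module _ {m ℓm n ℓn} (M : Module R m ℓm) (N : Module R n ℓn) where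
    private
      module M = Module M
      module N = Module N

    data TensorRel : Rel (Term (M.Carrierᴹ × N.Carrierᴹ)) (c ⊔ m ⊔ ℓm ⊔ n ⊔ ℓn) where
      tensor-cong : ∀ {u v x y} → u M.≈ᴹ v → x N.≈ᴹ y →
                    TensorRel (gen (u , x)) (gen (v , y))
      tensor-+ˡ   : ∀ u v x →
                    TensorRel (gen (u M.+ᴹ v , x)) (gen (u , x) ⊕ gen (v , x))
      tensor-+ʳ   : ∀ u x y →
                    TensorRel (gen (u , x N.+ᴹ y)) (gen (u , x) ⊕ gen (u , y))
      tensor-*ˡ   : ∀ a u x → TensorRel (gen (a M.*ₗ u , x)) (a · gen (u , x))
      tensor-*ʳ   : ∀ a u x → TensorRel (gen (u , a N.*ₗ x)) (a · gen (u , x))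

    Tensor : Module R (c ⊔ m ⊔ n) (c ⊔ ℓ ⊔ m ⊔ ℓm ⊔ n ⊔ ℓn)
    Tensor = Presented TensorRel

  module _ {p ℓp} (P : Module R p ℓp) where

    open Module P
    open SetoidReasoning ≈ᴹ-setoid
    open CommutativeSemigroupProperties
      (CommutativeMonoid.commutativeSemigroup +ᴹ-commutativeMonoid)
      using (interchange)

    extend : ∀ {x} {X : Set x} → (X → Carrierᴹ) → Term X → Carrierᴹ
    extend f (gen x) = f x
    extend f 𝟎       = 0ᴹ
    extend f (s ⊕ t) = extend f s +ᴹ extend f t
    extend f (a · t) = a *ₗ extend f t

    extend-≋ : ∀ {x ℓx} {X : Set x} {_∼_ : Rel (Term X) ℓx} (f : X → Carrierᴹ) →
               (∀ {s t} → s ∼ t → extend f s ≈ᴹ extend f t) →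
               ∀ {s t} → _∼_ ⊢ s ≋ t → extend f s ≈ᴹ extend f t
    extend-≋ f resp (rel s∼t)          = resp s∼t
    extend-≋ f resp refl               = ≈ᴹ-refl
    extend-≋ f resp (sym e)            = ≈ᴹ-sym (extend-≋ f resp e)
    extend-≋ f resp (trans d e)        = ≈ᴹ-trans (extend-≋ f resp d) (extend-≋ f resp e)
    extend-≋ f resp (⊕-cong d e)       = +ᴹ-cong (extend-≋ f resp d) (extend-≋ f resp e)
    extend-≋ f resp (·-cong a≈b e)     = *ₗ-cong a≈b (extend-≋ f resp e)
    extend-≋ f resp (⊕-assoc s t u)    = +ᴹ-assoc _ _ _
    extend-≋ f resp (⊕-comm s t)       = +ᴹ-comm _ _
    extend-≋ f resp (⊕-identity t)     = +ᴹ-identityˡ _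
    extend-≋ f resp (·-zero t)         = *ₗ-zeroˡ _
    extend-≋ f resp (·-identity t)     = *ₗ-identityˡ _
    extend-≋ f resp (·-assoc a b t)    = *ₗ-assoc _ _ _
    extend-≋ f resp (·-distribˡ a s t) = *ₗ-distribˡ _ _ _
    extend-≋ f resp (·-distribʳ a b t) = *ₗ-distribʳ _ _ _

    module _ {x} {X : Set x} where

      extend-cong : {f g : X → Carrierᴹ} → (∀ u → f u ≈ᴹ g u) →
                    ∀ t → extend f t ≈ᴹ extend g t
      extend-cong f≈g (gen u) = f≈g u
      extend-cong f≈g 𝟎       = ≈ᴹ-refl
      extend-cong f≈g (s ⊕ t) = +ᴹ-cong (extend-cong f≈g s) (extend-cong f≈g t)
      extend-cong f≈g (a · t) = *ₗ-cong R.refl (extend-cong f≈g t)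

      extend-+ : {f g h : X → Carrierᴹ} → (∀ u → h u ≈ᴹ f u +ᴹ g u) →
                 ∀ t → extend h t ≈ᴹ extend f t +ᴹ extend g t
      extend-+ h≈f+g (gen u) = h≈f+g u
      extend-+ h≈f+g 𝟎       = ≈ᴹ-sym (+ᴹ-identityˡ 0ᴹ)
      extend-+ h≈f+g (s ⊕ t) =
        ≈ᴹ-trans (+ᴹ-cong (extend-+ h≈f+g s) (extend-+ h≈f+g t)) (interchange _ _ _ _)
      extend-+ h≈f+g (a · t) =
        ≈ᴹ-trans (*ₗ-cong R.refl (extend-+ h≈f+g t)) (*ₗ-distribˡ a _ _)

      extend-* : ∀ b {f h : X → Carrierᴹ} → (∀ u → h u ≈ᴹ b *ₗ f u) →
                 ∀ t → extend h t ≈ᴹ b *ₗ extend f t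
      extend-* b h≈bf (gen u) = h≈bf u
      extend-* b h≈bf 𝟎       = ≈ᴹ-sym (*ₗ-zeroʳ b)
      extend-* b h≈bf (s ⊕ t) =
        ≈ᴹ-trans (+ᴹ-cong (extend-* b h≈bf s) (extend-* b h≈bf t)) (≈ᴹ-sym (*ₗ-distribˡ b _ _))
      extend-* b {f} {h} h≈bf (a · t) = begin
        a *ₗ extend h t        ≈⟨ *ₗ-cong R.refl (extend-* b h≈bf t) ⟩
        a *ₗ b *ₗ extend f t   ≈⟨ *ₗ-assoc a b _ ⟨
        (a R.* b) *ₗ extend f t ≈⟨ *ₗ-cong (R.*-comm a b) ≈ᴹ-refl ⟩
        (b R.* a) *ₗ extend f t ≈⟨ *ₗ-assoc b a _ ⟩
        b *ₗ a *ₗ extend f t   ∎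

  -- A family of maps F α : A → P, linear in A, extends to Free Ω ⊗ A → P
  -- by  gen α ⊗ x ↦ F α x.

  module _ {o ℓo a ℓa p ℓp} (Ω : Setoid o ℓo) (A : Module R a ℓa) (P : Module R p ℓp) where
    private
      module Ω = Setoid Ω
      module A = Module A
      module P = Module P

    lift : (Ω.Carrier → A.Carrierᴹ → P.Carrierᴹ) →
           Term (Term Ω.Carrier × A.Carrierᴹ) → P.Carrierᴹ
    lift F = extend P λ (u , x) → extend P (λ α → F α x) u

    record IsLinearFamily (F : Ω.Carrier → A.Carrierᴹ → P.Carrierᴹ)
                          : Set (c ⊔ o ⊔ ℓo ⊔ a ⊔ ℓa ⊔ ℓp) where
      field
        F-cong : ∀ {α β x y} → α Ω.≈ β → x A.≈ᴹ y → F α x P.≈ᴹ F β y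
        F-+    : ∀ α x y → F α (x A.+ᴹ y) P.≈ᴹ F α x P.+ᴹ F α y
        F-*    : ∀ α b x → F α (b A.*ₗ x) P.≈ᴹ b P.*ₗ F α x

    lift-≋ : ∀ {F} → IsLinearFamily F →
             ∀ {s t} → TensorRel (Free Ω) A ⊢ s ≋ t → lift F s P.≈ᴹ lift F t
    lift-≋ {F} isLinear = extend-≋ P _ respects
      where
      open IsLinearFamily isLinear

      respects : ∀ {s t} → TensorRel (Free Ω) A s t → lift F s P.≈ᴹ lift F t
      respects (tensor-cong {u} {v} {x} {y} u≈v x≈y) = P.≈ᴹ-trans
        (extend-cong P (λ α → F-cong Ω.refl x≈y) u)
        (extend-≋ P (λ α → F α y) (λ { (basis α≈β) → F-cong α≈β A.≈ᴹ-refl }) u≈v)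
      respects (tensor-+ˡ u v x) = P.≈ᴹ-refl
      respects (tensor-+ʳ u x y) = extend-+ P (λ α → F-+ α x y) u
      respects (tensor-*ˡ b u x) = P.≈ᴹ-refl
      respects (tensor-*ʳ b u x) = extend-* P b (λ α → F-* α b x) u

    lift-cong : ∀ {F G} → (∀ α x → F α x P.≈ᴹ G α x) → ∀ t → lift F t P.≈ᴹ lift G t
    lift-cong e = extend-cong P λ (u , x) → extend-cong P (λ α → e α x) u

    lift-+ : ∀ {F G H} → (∀ α x → H α x P.≈ᴹ F α x P.+ᴹ G α x) →
             ∀ t → lift H t P.≈ᴹ lift F t P.+ᴹ lift G t
    lift-+ e = extend-+ P λ (u , x) → extend-+ P (λ α → e α x) u

    lift-* : ∀ b {F H} → (∀ α x → H α x P.≈ᴹ b P.*ₗ F α x) →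
             ∀ t → lift H t P.≈ᴹ b P.*ₗ lift F t
    lift-* b e = extend-* P b λ (u , x) → extend-* P b (λ α → e α x) u

  -- The bilinear product on  KΩ ⊗ A  determined by
  --   (α ⊗ x) ∙ (β ⊗ y) = (α ∗ β) ⊗ (x ∙_{α ⋆ β} y).

  module _ {o ℓo a ℓa} (Ω : Setoid o ℓo) (A : Module R a ℓa) where
    private
      module Ω = Setoid Ω
      module A = Module A

      T : Module R (c ⊔ o ⊔ a) (c ⊔ ℓ ⊔ o ⊔ ℓo ⊔ a ⊔ ℓa)
      T = Tensor (Free Ω) A

      module T = Module T

    infix 8 _⊗_

    _⊗_ : Ω.Carrier → A.Carrierᴹ → T.Carrierᴹ
    α ⊗ x = gen (gen α , x)

    module _ (_∗_ _⋆_ : Op₂ Ω.Carrier) (family : BilinearFamily A Ω) where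
      open BilinearFamily family using (op)

      productOp : Op₂ T.Carrierᴹ
      productOp s t =
        lift Ω A T (λ α x → lift Ω A T (λ β y → (α ∗ β) ⊗ op (α ⋆ β) x y) t) s

      productOp-⊗ : ∀ α β x y → productOp (α ⊗ x) (β ⊗ y) ≡ (α ∗ β) ⊗ op (α ⋆ β) x y
      productOp-⊗ α β x y = refl

    product : (_∗_ _⋆_ : Op₂ Ω.Carrier) →
              AlgebraicDefinitions.Congruent₂ Ω._≈_ _∗_ →
              AlgebraicDefinitions.Congruent₂ Ω._≈_ _⋆_ →
              BilinearFamily A Ω → BilinearProduct T
    product _∗_ _⋆_ ∗-cong ⋆-cong family = record
      { _∙_        = productOp _∗_ _⋆_ family
      ; isBilinear = record
        { ∙-cong   = λ {s} {s′} {t} {t′} s≋s′ t≋t′ →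
            trans (lift-≋ Ω A T (outer t) s≋s′)
                  (lift-cong Ω A T (λ α x → lift-≋ Ω A T (inner α x) t≋t′) s′)
        ; distribˡ = λ s t u → lift-+ Ω A T (λ α x → refl) s
        ; distribʳ = λ s t u → refl
        ; scaleˡ   = λ b s t → refl
        ; scaleʳ   = λ b s t → lift-* Ω A T b (λ α x → refl) s
        }
      }
      where
      open BilinearFamily family

      ⊗-cong : ∀ {α β x y} → α Ω.≈ β → x A.≈ᴹ y → α ⊗ x T.≈ᴹ β ⊗ y
      ⊗-cong α≈β x≈y = rel (tensor-cong (rel (basis α≈β)) x≈y)

      inner : ∀ α x → IsLinearFamily Ω A T (λ β y → (α ∗ β) ⊗ op (α ⋆ β) x y)
      inner α x = record
        { F-cong = λ {β} {γ} {y} {z} β≈γ y≈z → ⊗-cong (∗-cong Ω.refl β≈γ)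
            (A.≈ᴹ-trans (index-cong (⋆-cong Ω.refl β≈γ) x y)
                        (∙-cong (α ⋆ γ) A.≈ᴹ-refl y≈z))
        ; F-+    = λ β y z → trans (⊗-cong Ω.refl (distribˡ (α ⋆ β) x y z))
                                   (rel (tensor-+ʳ _ _ _))
        ; F-*    = λ β b y → trans (⊗-cong Ω.refl (scaleʳ (α ⋆ β) b x y))
                                   (rel (tensor-*ʳ _ _ _))
        }

      outer : ∀ t → IsLinearFamily Ω A T
                      (λ α x → lift Ω A T (λ β y → (α ∗ β) ⊗ op (α ⋆ β) x y) t)
      outer t = record
        { F-cong = λ {α} {γ} {x} {z} α≈γ x≈z → lift-cong Ω A T
            (λ β y → ⊗-cong (∗-cong α≈γ Ω.refl)
              (A.≈ᴹ-trans (index-cong (⋆-cong α≈γ Ω.refl) x y)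
                          (∙-cong (γ ⋆ β) x≈z A.≈ᴹ-refl))) t
        ; F-+    = λ α x z → lift-+ Ω A T
            (λ β y → trans (⊗-cong Ω.refl (distribʳ (α ⋆ β) y x z))
                           (rel (tensor-+ʳ _ _ _))) t
        ; F-*    = λ α b x → lift-* Ω A T b
            (λ β y → trans (⊗-cong Ω.refl (scaleˡ (α ⋆ β) b x y))
                           (rel (tensor-*ʳ _ _ _))) t
        }

  module _ {o ℓo a ℓa} (Ω : EDS o ℓo) (A : Module R a ℓa) where
    private module Ω = EDS Ω

    Ω⊗ : Module R (c ⊔ o ⊔ a) (c ⊔ ℓ ⊔ o ⊔ ℓo ⊔ a ⊔ ℓa)
    Ω⊗ = Tensor (Free Ω.setoid) A

    tensor≺ : BilinearFamily A Ω.setoid → BilinearProduct Ω⊗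
    tensor≺ = product Ω.setoid A Ω._⟵_ Ω._◁_ Ω.⟵-cong Ω.◁-cong

    tensor≻ : BilinearFamily A Ω.setoid → BilinearProduct Ω⊗
    tensor≻ = product Ω.setoid A Ω._⟶_ Ω._▷_ Ω.⟶-cong Ω.▷-cong

{-# OPTIONS --safe #-}

-- Both implications compare the dendriform axioms on pure tensors
-- α ⊗ x, β ⊗ y, γ ⊗ z; there the EDS axioms turn them into the Ω-dendriform
-- axioms at one particular pair of indices (α′ , β′) depending on α, β, γ.
-- Trilinearity then gives the first part.  For the converse, the augmentation
-- ω ⊗ x ↦ x recovers the identity in A, and surjectivity of φ⟵ and φ⟶ shows
-- that every pair (α′ , β′) is reached.

module Submission where

open import Defs
open import Level using (_⊔_)
open import Algebra.Apartness.Bundles using (HeytingField)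
open import Algebra.Bundles using (CommutativeMonoid; CommutativeRing)
import Algebra.Properties.CommutativeSemigroup as CommutativeSemigroupProperties
open import Algebra.Module.Bundles using (Module)
open import Data.Product.Base using (_×_; _,_; ∃₂)
open import Relation.Binary.Bundles using (Setoid)
open import Relation.Binary.Core using (Rel)
import Relation.Binary.Reasoning.Setoid as SetoidReasoning

module _ {c ℓ} {R : CommutativeRing c ℓ} where

  private module R = CommutativeRing R

  -- Linear maps out of presented modules and tensor products.

  module _ {m ℓm n ℓn} (M : Module R m ℓm) (N : Module R n ℓn) where
    private
      module M = Module M
      module N = Module N

    record IsLinear (f : M.Carrierᴹ → N.Carrierᴹ) : Set (c ⊔ m ⊔ ℓm ⊔ ℓn) where
      field
        cong   : ∀ {x y} → x M.≈ᴹ y → f x N.≈ᴹ f y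
        +-homo : ∀ x y → f (x M.+ᴹ y) N.≈ᴹ f x N.+ᴹ f y
        *-homo : ∀ r x → f (r M.*ₗ x) N.≈ᴹ r N.*ₗ f x

      0-homo : f M.0ᴹ N.≈ᴹ N.0ᴹ
      0-homo = begin
        f M.0ᴹ               ≈⟨ cong (M.*ₗ-zeroˡ M.0ᴹ) ⟨
        f (R.0# M.*ₗ M.0ᴹ)   ≈⟨ *-homo R.0# M.0ᴹ ⟩
        R.0# N.*ₗ f M.0ᴹ     ≈⟨ N.*ₗ-zeroˡ _ ⟩
        N.0ᴹ                 ∎
        where
        open SetoidReasoning N.≈ᴹ-setoid

  module _ {n ℓn} {N : Module R n ℓn} where
    private module N = Module N

    -- Induction on formal expressions works for any linear `f` and `g`, not only those built with
    -- `extend`, because the constructors of `Term` are the module operations themselves.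
    presented-ext : ∀ {x ℓx} {X : Set x} {_∼_ : Rel (Term X) ℓx} {f g} →
                    IsLinear (Presented _∼_) N f → IsLinear (Presented _∼_) N g →
                    (∀ u → f (gen u) N.≈ᴹ g (gen u)) → ∀ t → f t N.≈ᴹ g t
    presented-ext {f = f} {g} F G f≈g = go
      where
      module F = IsLinear F
      module G = IsLinear G

      go : ∀ t → f t N.≈ᴹ g t
      go (gen u) = f≈g u
      go 𝟎       = N.≈ᴹ-trans F.0-homo (N.≈ᴹ-sym G.0-homo)
      go (s ⊕ t) = N.≈ᴹ-trans (F.+-homo s t)
        (N.≈ᴹ-trans (N.+ᴹ-cong (go s) (go t)) (N.≈ᴹ-sym (G.+-homo s t)))
      go (r · t) = N.≈ᴹ-trans (F.*-homo r t)
        (N.≈ᴹ-trans (N.*ₗ-cong R.refl (go t)) (N.≈ᴹ-sym (G.*-homo r t)))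

    module _ {o ℓo a ℓa} {Ω : Setoid o ℓo} {A : Module R a ℓa} where
      private
        module A = Module A

        infix 8 _⊗′_
        _⊗′_ = _⊗_ Ω A

      -- The defining relations of the tensor product in its left factor say exactly that pairing
      -- with a fixed `x` is linear.
      restrict-linear : ∀ {f} → IsLinear (Tensor (Free Ω) A) N f →
                        ∀ x → IsLinear (Free Ω) N (λ u → f (gen (u , x)))
      restrict-linear F x = record
        { cong   = λ u≈v → cong (rel (tensor-cong u≈v A.≈ᴹ-refl))
        ; +-homo = λ u v → N.≈ᴹ-trans (cong (rel (tensor-+ˡ u v x))) (+-homo _ _)
        ; *-homo = λ r u → N.≈ᴹ-trans (cong (rel (tensor-*ˡ r u x))) (*-homo _ _)
        }
        where
        open IsLinear F

      -- A generator of the tensor product pairs `x` with an arbitrary element of the free module,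
      -- so extensionality is applied twice: first to reach such pairs, then to reduce the left
      -- entry to a basis element.
      tensor-ext : ∀ {f g} →
                   IsLinear (Tensor (Free Ω) A) N f → IsLinear (Tensor (Free Ω) A) N g →
                   (∀ α x → f (α ⊗′ x) N.≈ᴹ g (α ⊗′ x)) → ∀ t → f t N.≈ᴹ g t
      tensor-ext F G f≈g = presented-ext F G λ (u , x) →
        presented-ext (restrict-linear F x) (restrict-linear G x) (λ α → f≈g α x) u

  -- Trilinear maps and the closure properties that cover both sides of the dendriform axioms.

  module _ {m ℓm} (M : Module R m ℓm) where
    open Module M

    record IsTrilinear (f : Carrierᴹ → Carrierᴹ → Carrierᴹ → Carrierᴹ)
                       : Set (c ⊔ m ⊔ ℓm) where
      field
        linear₁ : ∀ y z → IsLinear M M (λ x → f x y z)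
        linear₂ : ∀ x z → IsLinear M M (λ y → f x y z)
        linear₃ : ∀ x y → IsLinear M M (λ z → f x y z)

  module _ {m ℓm} {M : Module R m ℓm} where
    open Module M
    open CommutativeSemigroupProperties
      (CommutativeMonoid.commutativeSemigroup +ᴹ-commutativeMonoid)
      using (interchange)

    +-linear : ∀ {f g} → IsLinear M M f → IsLinear M M g →
               IsLinear M M (λ x → f x +ᴹ g x)
    +-linear F G = record
      { cong   = λ x≈y → +ᴹ-cong (F.cong x≈y) (G.cong x≈y)
      ; +-homo = λ x y → ≈ᴹ-trans (+ᴹ-cong (F.+-homo x y) (G.+-homo x y)) (interchange _ _ _ _)
      ; *-homo = λ r x → ≈ᴹ-trans (+ᴹ-cong (F.*-homo r x) (G.*-homo r x)) (≈ᴹ-sym (*ₗ-distribˡ r _ _))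
      }
      where
      module F = IsLinear F
      module G = IsLinear G

    ∘-linear : ∀ {f g} → IsLinear M M f → IsLinear M M g → IsLinear M M (λ x → f (g x))
    ∘-linear F G = record
      { cong   = λ x≈y → F.cong (G.cong x≈y)
      ; +-homo = λ x y → ≈ᴹ-trans (F.cong (G.+-homo x y)) (F.+-homo _ _)
      ; *-homo = λ r x → ≈ᴹ-trans (F.cong (G.*-homo r x)) (F.*-homo _ _)
      }
      where
      module F = IsLinear F
      module G = IsLinear G

    module _ (B : BilinearProduct M) where
      open BilinearProduct B

      ∙-linearˡ : ∀ y → IsLinear M M (_∙ y)
      ∙-linearˡ y = record
        { cong   = λ x≈x′ → ∙-cong x≈x′ ≈ᴹ-refl
        ; +-homo = λ x x′ → distribʳ y x x′
        ; *-homo = λ r x → scaleˡ r x y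
        }

      ∙-linearʳ : ∀ x → IsLinear M M (x ∙_)
      ∙-linearʳ x = record
        { cong   = ∙-cong ≈ᴹ-refl
        ; +-homo = distribˡ x
        ; *-homo = λ r y → scaleʳ r x y
        }

    module _ (B C : BilinearProduct M) where
      open BilinearProduct B using (_∙_)
      open BilinearProduct C using () renaming (_∙_ to infixl 7 _∘_)

      leftNested-trilinear : IsTrilinear M (λ x y z → (x ∙ y) ∘ z)
      leftNested-trilinear = record
        { linear₁ = λ y z → ∘-linear (∙-linearˡ C z) (∙-linearˡ B y)
        ; linear₂ = λ x z → ∘-linear (∙-linearˡ C z) (∙-linearʳ B x)
        ; linear₃ = λ x y → ∙-linearʳ C (x ∙ y)
        }

      rightNested-trilinear : IsTrilinear M (λ x y z → x ∙ (y ∘ z))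
      rightNested-trilinear = record
        { linear₁ = λ y z → ∙-linearˡ B (y ∘ z)
        ; linear₂ = λ x z → ∘-linear (∙-linearʳ B x) (∙-linearˡ C z)
        ; linear₃ = λ x y → ∘-linear (∙-linearʳ B x) (∙-linearʳ C y)
        }

    +-trilinear : ∀ {f g} → IsTrilinear M f → IsTrilinear M g →
                  IsTrilinear M (λ x y z → f x y z +ᴹ g x y z)
    +-trilinear F G = record
      { linear₁ = λ y z → +-linear (F.linear₁ y z) (G.linear₁ y z)
      ; linear₂ = λ x z → +-linear (F.linear₂ x z) (G.linear₂ x z)
      ; linear₃ = λ x y → +-linear (F.linear₃ x y) (G.linear₃ x y)
      }
      where
      module F = IsTrilinear F
      module G = IsTrilinear G

  -- Trilinear extension from pure tensors, and the augmentation.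

  module _ {o ℓo a ℓa} {Ω : Setoid o ℓo} {A : Module R a ℓa} where
    private
      module A = Module A

      T : Module R (c ⊔ o ⊔ a) (c ⊔ ℓ ⊔ o ⊔ ℓo ⊔ a ⊔ ℓa)
      T = Tensor (Free Ω) A

      module T = Module T

      infix 8 _⊗′_
      _⊗′_ = _⊗_ Ω A

    -- One argument is reduced to pure tensors at a time, the earlier ones being already pure and
    -- the later ones still arbitrary.
    tensor-ext₃ : ∀ {f g} → IsTrilinear T f → IsTrilinear T g →
                  (∀ α β γ x y z → f (α ⊗′ x) (β ⊗′ y) (γ ⊗′ z) T.≈ᴹ
                                   g (α ⊗′ x) (β ⊗′ y) (γ ⊗′ z)) →
                  ∀ s t u → f s t u T.≈ᴹ g s t u
    tensor-ext₃ F G f≈g s t u =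
      tensor-ext (F.linear₁ t u) (G.linear₁ t u) (λ α x →
        tensor-ext (F.linear₂ _ u) (G.linear₂ _ u) (λ β y →
          tensor-ext (F.linear₃ _ _) (G.linear₃ _ _) (λ γ z →
            f≈g α β γ x y z) u) t) s
      where
      module F = IsTrilinear F
      module G = IsTrilinear G

    ⊗-cong : ∀ {α β x y} → Setoid._≈_ Ω α β → x A.≈ᴹ y → α ⊗′ x T.≈ᴹ β ⊗′ y
    ⊗-cong α≈β x≈y = rel (tensor-cong (rel (basis α≈β)) x≈y)

    -- This is the counit of the free module, sending each basis element to 1, tensored with the
    -- identity of `A`. It forgets the `Ω`-component, so no linear independence of the basis is
    -- needed to extract identities in `A`.
    augment : T.Carrierᴹ → A.Carrierᴹ
    augment = lift Ω A A (λ _ x → x)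

    augment-cong : ∀ {s t} → s T.≈ᴹ t → augment s A.≈ᴹ augment t
    augment-cong = lift-≋ Ω A A record
      { F-cong = λ _ x≈y → x≈y
      ; F-+    = λ _ _ _ → A.≈ᴹ-refl
      ; F-*    = λ _ _ _ → A.≈ᴹ-refl
      }

    op-cong : (∙ : BilinearFamily A Ω) →
              ∀ {α β x x′ y y′} → Setoid._≈_ Ω α β → x A.≈ᴹ x′ → y A.≈ᴹ y′ →
              BilinearFamily.op ∙ α x y A.≈ᴹ BilinearFamily.op ∙ β x′ y′
    op-cong ∙ {β = β} α≈β x≈x′ y≈y′ =
      A.≈ᴹ-trans (index-cong α≈β _ _) (∙-cong β x≈x′ y≈y′)
      where
      open BilinearFamily ∙

  -- From the Ω-dendriform axioms to the dendriform axioms.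

  module _ {o ℓo a ℓa} (Ω : EDS o ℓo) (A : Module R a ℓa)
           (prec succ : BilinearFamily A (EDS.setoid Ω)) where
    private
      module Ω where
        open EDS Ω public
        open Setoid (EDS.setoid Ω) public using (refl; sym; trans)
      module A = Module A
      module T = Module (Ω⊗ Ω A)
      ≺′ = tensor≺ Ω A prec
      ≻′ = tensor≻ Ω A succ

    open BilinearProduct ≺′ using () renaming (_∙_ to infixl 7 _≺_)
    open BilinearProduct ≻′ using () renaming (_∙_ to infixl 7 _≻_)
    open BilinearFamily prec using () renaming (op to ≺[_])
    open BilinearFamily succ using () renaming (op to ≻[_])

    dendriform : IsΩDendriform Ω A prec succ → IsDendriform (Ω⊗ Ω A) ≺′ ≻′
    dendriform D = record
      -- The sum inside the product is distributed so that both sides are assembled from nested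
      -- products, whose trilinearity is known.
      { ≺-≺ = λ s t u → T.≈ᴹ-trans
          (tensor-ext₃ (leftNested-trilinear ≺′ ≺′)
            (+-trilinear (rightNested-trilinear ≺′ ≺′) (rightNested-trilinear ≺′ ≻′))
            ≺-≺-⊗ s t u)
          (T.≈ᴹ-sym (BilinearProduct.distribˡ ≺′ s (t ≺ u) (t ≻ u)))
      ; ≻-≺ = tensor-ext₃ (leftNested-trilinear ≻′ ≺′) (rightNested-trilinear ≻′ ≺′) ≻-≺-⊗
      ; ≻-≻ = λ s t u → T.≈ᴹ-trans
          (BilinearProduct.distribʳ ≻′ u (s ≺ t) (s ≻ t))
          (tensor-ext₃
            (+-trilinear (leftNested-trilinear ≺′ ≻′) (leftNested-trilinear ≻′ ≻′))
            (rightNested-trilinear ≻′ ≻′)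
            ≻-≻-⊗ s t u)
      }
      where
      module D = IsΩDendriform D

      infix 8 _⊗′_
      _⊗′_ = _⊗_ Ω.setoid A

      open SetoidReasoning T.≈ᴹ-setoid

      -- The Ω-dendriform axiom is used at the pair `α ◁ β`, `(α ⟵ β) ◁ γ`.
      ≺-≺-⊗ : ∀ α β γ x y z →
              (α ⊗′ x ≺ β ⊗′ y) ≺ γ ⊗′ z T.≈ᴹ
              α ⊗′ x ≺ (β ⊗′ y ≺ γ ⊗′ z) T.+ᴹ α ⊗′ x ≺ (β ⊗′ y ≻ γ ⊗′ z)
      ≺-≺-⊗ α β γ x y z = begin
        ((α Ω.⟵ β) Ω.⟵ γ) ⊗′ ≺[ (α Ω.⟵ β) Ω.◁ γ ] (≺[ α Ω.◁ β ] x y) z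
          ≈⟨ ⊗-cong (Ω.⟵-assoc α β γ) (A.≈ᴹ-trans (D.≺-≺ _ _ x y z) (A.+ᴹ-cong
               (op-cong prec (Ω.◁-⟵-◁ α β γ) A.≈ᴹ-refl (op-cong prec (Ω.◁-◁-◁ α β γ) A.≈ᴹ-refl A.≈ᴹ-refl))
               (op-cong prec (Ω.◁-⟶-◁ α β γ) A.≈ᴹ-refl (op-cong succ (Ω.◁-▷-◁ α β γ) A.≈ᴹ-refl A.≈ᴹ-refl)))) ⟩
        _ ≈⟨ rel (tensor-+ʳ _ _ _) ⟩
        -- Splitting the tensor gave both summands the component `α ⟵ (β ⟵ γ)`; the second needs
        -- `α ⟵ (β ⟶ γ)`.
        _ ≈⟨ T.+ᴹ-cong T.≈ᴹ-refl (⊗-cong (Ω.⟵-⟵≈⟵-⟶ α β γ) A.≈ᴹ-refl) ⟩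
        α ⊗′ x ≺ (β ⊗′ y ≺ γ ⊗′ z) T.+ᴹ α ⊗′ x ≺ (β ⊗′ y ≻ γ ⊗′ z) ∎

      -- The relevant pair of indices is `α ▷ β`, `β ◁ γ`.
      ≻-≺-⊗ : ∀ α β γ x y z →
              (α ⊗′ x ≻ β ⊗′ y) ≺ γ ⊗′ z T.≈ᴹ α ⊗′ x ≻ (β ⊗′ y ≺ γ ⊗′ z)
      ≻-≺-⊗ α β γ x y z = ⊗-cong (Ω.⟶-⟵-assoc α β γ) (A.≈ᴹ-trans
        (op-cong prec (Ω.⟶-◁ α β γ) A.≈ᴹ-refl A.≈ᴹ-refl) (A.≈ᴹ-trans
        (A.≈ᴹ-sym (D.≻-≺ _ _ x y z))
        (op-cong succ (Ω.sym (Ω.▷-⟵ α β γ)) A.≈ᴹ-refl A.≈ᴹ-refl)))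

      -- The Ω-dendriform axiom is used at the pair `α ▷ (β ⟶ γ)`, `β ▷ γ`. Its two summands come in
      -- the opposite order, hence the commutation.
      ≻-≻-⊗ : ∀ α β γ x y z →
              (α ⊗′ x ≺ β ⊗′ y) ≻ γ ⊗′ z T.+ᴹ (α ⊗′ x ≻ β ⊗′ y) ≻ γ ⊗′ z T.≈ᴹ
              α ⊗′ x ≻ (β ⊗′ y ≻ γ ⊗′ z)
      ≻-≻-⊗ α β γ x y z = T.≈ᴹ-sym (begin
        (α Ω.⟶ (β Ω.⟶ γ)) ⊗′ ≻[ α Ω.▷ (β Ω.⟶ γ) ] x (≻[ β Ω.▷ γ ] y z)
          ≈⟨ ⊗-cong (Ω.sym (Ω.⟵-⟶-assoc α β γ)) (A.≈ᴹ-trans (D.≻-≻ _ _ x y z) (A.≈ᴹ-trans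
               (A.+ᴹ-cong
                 (op-cong succ (Ω.▷-⟶-▷ α β γ) (op-cong succ (Ω.▷-▷-▷ α β γ) A.≈ᴹ-refl A.≈ᴹ-refl) A.≈ᴹ-refl)
                 (op-cong succ (Ω.▷-⟵-▷ α β γ) (op-cong prec (Ω.▷-◁-▷ α β γ) A.≈ᴹ-refl A.≈ᴹ-refl) A.≈ᴹ-refl))
               (A.+ᴹ-comm _ _))) ⟩
        _ ≈⟨ rel (tensor-+ʳ _ _ _) ⟩
        _ ≈⟨ T.+ᴹ-cong T.≈ᴹ-refl (⊗-cong (Ω.sym (Ω.⟶-⟶≈⟵-⟶ α β γ)) A.≈ᴹ-refl) ⟩
        (α ⊗′ x ≺ β ⊗′ y) ≻ γ ⊗′ z T.+ᴹ (α ⊗′ x ≻ β ⊗′ y) ≻ γ ⊗′ z ∎)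

    -- The converse under surjectivity.

    preimage⟵ : Ω.IsSurjective Ω.φ⟵ → ∀ δ ε → ∃₂ λ α β → (α Ω.⟵ β) Ω.≈ δ × (α Ω.◁ β) Ω.≈ ε
    preimage⟵ surj δ ε with (α , β) , eq ← surj (δ , ε) = α , β , eq (Ω.refl , Ω.refl)

    preimage⟶ : Ω.IsSurjective Ω.φ⟶ → ∀ δ ε → ∃₂ λ α β → (α Ω.⟶ β) Ω.≈ δ × (α Ω.▷ β) Ω.≈ ε
    preimage⟶ surj δ ε with (α , β) , eq ← surj (δ , ε) = α , β , eq (Ω.refl , Ω.refl)

    Ωdendriform : Ω.IsSurjective Ω.φ⟵ → Ω.IsSurjective Ω.φ⟶ →
                  IsDendriform (Ω⊗ Ω A) ≺′ ≻′ → IsΩDendriform Ω A prec succ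
    Ωdendriform surj⟵ surj⟶ D = record { ≺-≺ = ≺-≺ ; ≻-≺ = ≻-≺ ; ≻-≻ = ≻-≻ }
      where
      module D = IsDendriform D

      infix 8 _⊗′_
      _⊗′_ = _⊗_ Ω.setoid A

      open SetoidReasoning A.≈ᴹ-setoid

      ≺-≺ : ∀ α′ β′ x y z →
            ≺[ β′ ] (≺[ α′ ] x y) z A.≈ᴹ
            ≺[ α′ Ω.⟵ β′ ] x (≺[ α′ Ω.◁ β′ ] y z) A.+ᴹ ≺[ α′ Ω.⟶ β′ ] x (≻[ α′ Ω.▷ β′ ] y z)
      ≺-≺ α′ β′ x y z
        -- Only `δ ◁ γ ≈ β′` matters here, so the first target `β′` is an arbitrary filler.
        -- Factoring `δ` as `α ⟵ β` with `α ◁ β ≈ α′` then gives `(α ⟵ β) ◁ γ ≈ β′`.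
        with δ , γ , _ , δ◁γ ← preimage⟵ surj⟵ β′ β′
        with α , β , α⟵β , α◁β ← preimage⟵ surj⟵ δ α′ = begin
          ≺[ β′ ] (≺[ α′ ] x y) z
            ≈⟨ op-cong prec β″≈β′ (op-cong prec α◁β A.≈ᴹ-refl A.≈ᴹ-refl) A.≈ᴹ-refl ⟨
          ≺[ (α Ω.⟵ β) Ω.◁ γ ] (≺[ α Ω.◁ β ] x y) z
            -- On pure tensors both augmented sides compute to the displayed expressions; the sum
            -- inside the product splits by computation.
            ≈⟨ augment-cong (D.≺-≺ (α ⊗′ x) (β ⊗′ y) (γ ⊗′ z)) ⟩
          ≺[ α Ω.◁ (β Ω.⟵ γ) ] x (≺[ β Ω.◁ γ ] y z) A.+ᴹ
          ≺[ α Ω.◁ (β Ω.⟶ γ) ] x (≻[ β Ω.▷ γ ] y z)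
            ≈⟨ A.+ᴹ-cong
                 (op-cong prec (Ω.trans (Ω.sym (Ω.◁-⟵-◁ α β γ)) (Ω.⟵-cong α◁β β″≈β′)) A.≈ᴹ-refl
                   (op-cong prec (Ω.trans (Ω.sym (Ω.◁-◁-◁ α β γ)) (Ω.◁-cong α◁β β″≈β′)) A.≈ᴹ-refl A.≈ᴹ-refl))
                 (op-cong prec (Ω.trans (Ω.sym (Ω.◁-⟶-◁ α β γ)) (Ω.⟶-cong α◁β β″≈β′)) A.≈ᴹ-refl
                   (op-cong succ (Ω.trans (Ω.sym (Ω.◁-▷-◁ α β γ)) (Ω.▷-cong α◁β β″≈β′)) A.≈ᴹ-refl A.≈ᴹ-refl)) ⟩
          ≺[ α′ Ω.⟵ β′ ] x (≺[ α′ Ω.◁ β′ ] y z) A.+ᴹ ≺[ α′ Ω.⟶ β′ ] x (≻[ α′ Ω.▷ β′ ] y z) ∎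
        where
        β″≈β′ = Ω.trans (Ω.◁-cong α⟵β Ω.refl) δ◁γ

      ≻-≺ : ∀ α′ β′ x y z → ≻[ α′ ] x (≺[ β′ ] y z) A.≈ᴹ ≺[ β′ ] (≻[ α′ ] x y) z
      ≻-≺ α′ β′ x y z
        -- Now `δ` is factored through `φ⟶`: from `α ⟶ β ≈ δ` one gets `β ◁ γ ≈ (α ⟶ β) ◁ γ ≈ β′`,
        -- while `α ▷ (β ⟵ γ) ≈ α ▷ β ≈ α′`.
        with δ , γ , _ , δ◁γ ← preimage⟵ surj⟵ β′ β′
        with α , β , α⟶β , α▷β ← preimage⟶ surj⟶ δ α′ = begin
          ≻[ α′ ] x (≺[ β′ ] y z)
            ≈⟨ op-cong succ (Ω.trans (Ω.▷-⟵ α β γ) α▷β) A.≈ᴹ-refl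
                 (op-cong prec (Ω.trans (Ω.sym (Ω.⟶-◁ α β γ)) β″≈β′) A.≈ᴹ-refl A.≈ᴹ-refl) ⟨
          ≻[ α Ω.▷ (β Ω.⟵ γ) ] x (≺[ β Ω.◁ γ ] y z)
            ≈⟨ augment-cong (D.≻-≺ (α ⊗′ x) (β ⊗′ y) (γ ⊗′ z)) ⟨
          ≺[ (α Ω.⟶ β) Ω.◁ γ ] (≻[ α Ω.▷ β ] x y) z
            ≈⟨ op-cong prec β″≈β′ (op-cong succ α▷β A.≈ᴹ-refl A.≈ᴹ-refl) A.≈ᴹ-refl ⟩
          ≺[ β′ ] (≻[ α′ ] x y) z ∎
        where
        β″≈β′ = Ω.trans (Ω.◁-cong α⟶β Ω.refl) δ◁γ

      ≻-≻ : ∀ α′ β′ x y z →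
            ≻[ α′ ] x (≻[ β′ ] y z) A.≈ᴹ
            ≻[ α′ Ω.⟶ β′ ] (≻[ α′ Ω.▷ β′ ] x y) z A.+ᴹ ≻[ α′ Ω.⟵ β′ ] (≺[ α′ Ω.◁ β′ ] x y) z
      ≻-≻ α′ β′ x y z
        -- Mirror image of the first axiom: the right argument `δ` is factored as `β ⟶ γ` with
        -- `β ▷ γ ≈ β′`, so that `α ▷ (β ⟶ γ) ≈ α′`.
        with α , δ , _ , α▷δ ← preimage⟶ surj⟶ α′ α′
        with β , γ , β⟶γ , β▷γ ← preimage⟶ surj⟶ δ β′ = begin
          ≻[ α′ ] x (≻[ β′ ] y z)
            ≈⟨ op-cong succ α″≈α′ A.≈ᴹ-refl (op-cong succ β▷γ A.≈ᴹ-refl A.≈ᴹ-refl) ⟨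
          ≻[ α Ω.▷ (β Ω.⟶ γ) ] x (≻[ β Ω.▷ γ ] y z)
            ≈⟨ augment-cong (D.≻-≻ (α ⊗′ x) (β ⊗′ y) (γ ⊗′ z)) ⟨
          ≻[ (α Ω.⟵ β) Ω.▷ γ ] (≺[ α Ω.◁ β ] x y) z A.+ᴹ
          ≻[ (α Ω.⟶ β) Ω.▷ γ ] (≻[ α Ω.▷ β ] x y) z
            ≈⟨ A.+ᴹ-comm _ _ ⟩
          ≻[ (α Ω.⟶ β) Ω.▷ γ ] (≻[ α Ω.▷ β ] x y) z A.+ᴹ
          ≻[ (α Ω.⟵ β) Ω.▷ γ ] (≺[ α Ω.◁ β ] x y) z
            ≈⟨ A.+ᴹ-cong
                 (op-cong succ (Ω.trans (Ω.sym (Ω.▷-⟶-▷ α β γ)) (Ω.⟶-cong α″≈α′ β▷γ))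
                   (op-cong succ (Ω.trans (Ω.sym (Ω.▷-▷-▷ α β γ)) (Ω.▷-cong α″≈α′ β▷γ)) A.≈ᴹ-refl A.≈ᴹ-refl)
                   A.≈ᴹ-refl)
                 (op-cong succ (Ω.trans (Ω.sym (Ω.▷-⟵-▷ α β γ)) (Ω.⟵-cong α″≈α′ β▷γ))
                   (op-cong prec (Ω.trans (Ω.sym (Ω.▷-◁-▷ α β γ)) (Ω.◁-cong α″≈α′ β▷γ)) A.≈ᴹ-refl A.≈ᴹ-refl)
                   A.≈ᴹ-refl) ⟩
          ≻[ α′ Ω.⟶ β′ ] (≻[ α′ Ω.▷ β′ ] x y) z A.+ᴹ ≻[ α′ Ω.⟵ β′ ] (≺[ α′ Ω.◁ β′ ] x y) z ∎
        where
        α″≈α′ = Ω.trans (Ω.▷-cong Ω.refl β⟶γ) α▷δ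

proposition18 : ∀ {c ℓ₁ ℓ₂ o ℓo a ℓa}
    (K : HeytingField c ℓ₁ ℓ₂) (Ω : EDS o ℓo) (A : Module (scalars K) a ℓa)
    (≺ ≻ : BilinearFamily A (EDS.setoid Ω)) →
    (IsΩDendriform Ω A ≺ ≻ → IsDendriform (Ω⊗ Ω A) (tensor≺ Ω A ≺) (tensor≻ Ω A ≻))
    × (EDS.IsSurjective Ω (EDS.φ⟵ Ω) → EDS.IsSurjective Ω (EDS.φ⟶ Ω) →
    IsDendriform (Ω⊗ Ω A) (tensor≺ Ω A ≺) (tensor≻ Ω A ≻) → IsΩDendriform Ω A ≺ ≻)
proposition18 K Ω A ≺ ≻ = dendriform Ω A ≺ ≻ , Ωdendriform Ω A ≺ ≻
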